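{- Work in ZF (Zermelo–Fraenkel set theory without the Axiom of Choice). The following assertion (A) is equivalent to Zorn's Lemma, hence also to the Axiom of Choice. (A) For every partially ordered set $\mathbf P=(P,\leq)$ with maximum $1$ and every $a \in P$: if both (i) $a \leq p$ for every maximal$_{<1}$ element $p$ of $\mathbf P$, and (iii) for every unbounded$_{<1}$ chain $(e_i)_{i\in I}$ in $\mathbf P$ and for every $i\in I$ there is $r\in P$ such that $r<1$, $a\leq r$ and $e_i\leq r$, then $a$ is a non-generator. The same holds if in (iii) "for every $i \in I$" is replaced by "for some $i\in I$".
   Context: Let $\mathbf P=(P,\leq)$ be a poset with maximum $1$ (not assumed to be a semilattice). For $a,e \in P$, "$a \vee e = 1$" means that there is no $p \in P$ such that $p<1$, $a \leq p$ and $e \leq p$. An element $a\in P$ is a non-generator if, for every $e \in P$, $a\vee e=1$ implies $e=1$. An element $p\in P$ is maximal$_{<1}$ if $p<1$ and there is no $q \in P$ such that $p<q<1$. A chain is a nonempty subset that is linearly ordered by the induced order; chains are denoted as families $(e_i)_{i\in I}$. A chain $(e_i)_{i \in I}$ in $\mathbf P$ is unbounded$_{<1}$ if $e_i<1$ for every $i\in I$ and there is no $p\in P$ such that $p<1$ and $e_i\leq p$ for every $i \in I$. A chain $(e_i)_{i\in I}$ in a poset $\mathbf Q$ is unbounded if there is no $q\in Q$ such that $e_i\leq q$ for every $i\in I$. Zorn's Lemma is the statement: for every nonempty poset $\mathbf Q$, either $\mathbf Q$ has a maximal element, or there is an unbounded chain in $\mathbf Q$. -}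

module Defs where

open import Data.Product using (_×_; ∃)
open import Data.Sum using (_⊎_)
open import Level using (Level) renaming (suc to lsuc)
open import Relation.Binary.Core using (Rel)
open import Relation.Binary.Definitions using (Maximum) renaming (Irrelevant to Irrelevant₂)
open import Relation.Binary.PropositionalEquality using (_≡_)
open import Relation.Binary.Structures using (IsPartialOrder)
import Relation.Binary.Construct.NonStrictToStrict as ToStrict
open import Relation.Nullary using (¬_; Dec; Irrelevant)
open import Relation.Unary using (Pred; _∈_)

-- Classical set theory without choice is rendered as follows: sets are types
-- in a universe (with K, equality on a type is a proposition), propositions are
-- irrelevant types, excluded middle is assumed for propositions, and "there
-- exists" and "or" are truncated with ∥_∥. The truncation is omitted under a
-- negation, where it changes nothing.

-- The library's Axiom.ExcludedMiddle decides all types, so it yields an element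
-- of every type that is not empty, which is a global choice operator.
-- Restricted to irrelevant types it gives only classical logic.
PropositionalExcludedMiddle : (ℓ : Level) → Set (lsuc ℓ)
PropositionalExcludedMiddle ℓ = {P : Set ℓ} → Irrelevant P → Dec P

-- Under excluded middle for propositions (and function extensionality), double
-- negation is the propositional truncation: ∥ A ∥ says that A is inhabited,
-- without choosing an inhabitant.
∥_∥ : ∀ {ℓ} → Set ℓ → Set ℓ
∥ A ∥ = ¬ ¬ A

record PartialOrder (ℓ : Level) : Set (lsuc ℓ) where
  infix 4 _≤_ _<_
  field
    Carrier        : Set ℓ
    _≤_            : Rel Carrier ℓ
    isPartialOrder : IsPartialOrder _≡_ _≤_
    ≤-irrelevant   : Irrelevant₂ _≤_

  _<_ : Rel Carrier ℓ
  _<_ = ToStrict._<_ _≡_ _≤_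

module _ {ℓ : Level} (Q : PartialOrder ℓ) where
  open PartialOrder Q

  IsMaximal : Carrier → Set ℓ
  IsMaximal m = ¬ (∃ λ q → m < q)

  -- Subsets are arbitrary predicates. Whether x ∈ C may have several proofs is
  -- immaterial, because C only occurs in propositions about its members.
  IsChain : Pred Carrier ℓ → Set ℓ
  IsChain C = ∥ (∃ λ x → x ∈ C) ∥
            × (∀ x y → x ∈ C → y ∈ C → ∥ (x ≤ y ⊎ y ≤ x) ∥)

  IsUnboundedChain : Pred Carrier ℓ → Set ℓ
  IsUnboundedChain C = IsChain C × ¬ (∃ λ q → ∀ x → x ∈ C → x ≤ q)

ZornsLemma : (ℓ : Level) → Set (lsuc ℓ)
ZornsLemma ℓ = (Q : PartialOrder ℓ) → ∥ PartialOrder.Carrier Q ∥ →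
  ∥ ((∃ λ m → IsMaximal Q m) ⊎ (∃ λ C → IsUnboundedChain Q C)) ∥

AxiomOfChoice : (ℓ : Level) → Set (lsuc ℓ)
AxiomOfChoice ℓ = (I : Set ℓ) (X : I → Set ℓ) →
  (∀ i → ∥ X i ∥) → ∥ (∀ i → X i) ∥

module _ {ℓ : Level} (P : PartialOrder ℓ) (𝟏 : PartialOrder.Carrier P) where
  open PartialOrder P

  -- "a ∨ e = 1"; no join operation is assumed to exist.
  JoinIsTop : Carrier → Carrier → Set ℓ
  JoinIsTop a e = ¬ (∃ λ p → p < 𝟏 × a ≤ p × e ≤ p)

  IsNonGenerator : Carrier → Set ℓ
  IsNonGenerator a = ∀ e → JoinIsTop a e → e ≡ 𝟏

  IsMaximal<1 : Carrier → Set ℓ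
  IsMaximal<1 p = p < 𝟏 × ¬ (∃ λ q → p < q × q < 𝟏)

  IsUnbounded<1Chain : Pred Carrier ℓ → Set ℓ
  IsUnbounded<1Chain C = IsChain P C
    × (∀ x → x ∈ C → x < 𝟏)
    × ¬ (∃ λ p → p < 𝟏 × (∀ x → x ∈ C → x ≤ p))

  BelowMaximals : Carrier → Set ℓ
  BelowMaximals a = ∀ p → IsMaximal<1 p → a ≤ p

  HasCommonBound<1 : Carrier → Carrier → Set ℓ
  HasCommonBound<1 a x = ∥ (∃ λ r → r < 𝟏 × a ≤ r × x ≤ r) ∥

  ChainCondition∀ : Carrier → Set (lsuc ℓ)
  ChainCondition∀ a = (C : Pred Carrier ℓ) → IsUnbounded<1Chain C →
    ∀ x → x ∈ C → HasCommonBound<1 a x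

  ChainCondition∃ : Carrier → Set (lsuc ℓ)
  ChainCondition∃ a = (C : Pred Carrier ℓ) → IsUnbounded<1Chain C →
    ∥ (∃ λ x → x ∈ C × HasCommonBound<1 a x) ∥

NonGeneratorCriterion∀ : (ℓ : Level) → Set (lsuc ℓ)
NonGeneratorCriterion∀ ℓ =
  (P : PartialOrder ℓ) → let open PartialOrder P in
  (𝟏 : Carrier) → Maximum _≤_ 𝟏 → (a : Carrier) →
  BelowMaximals P 𝟏 a → ChainCondition∀ P 𝟏 a → IsNonGenerator P 𝟏 a

NonGeneratorCriterion∃ : (ℓ : Level) → Set (lsuc ℓ)
NonGeneratorCriterion∃ ℓ =
  (P : PartialOrder ℓ) → let open PartialOrder P in
  (𝟏 : Carrier) → Maximum _≤_ 𝟏 → (a : Carrier) →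
  BelowMaximals P 𝟏 a → ChainCondition∃ P 𝟏 a → IsNonGenerator P 𝟏 a

-- The criterion follows from Zorn's Lemma applied to { p | e ≤ p < 1 }: a maximal
-- element or an unbounded chain there is one (below 1) in P, and yields a common
-- bound of a and e. Conversely, if Q had neither a maximal element nor an
-- unbounded chain, adjoin to Q a top 1 and a point a comparable only to itself and
-- 1. Then a is the only maximal element below 1 and no chain is unbounded below 1,
-- so a would be a non-generator; but a ∨ q = 1 for every q in Q.
--
-- The Axiom of Choice gives Zorn's Lemma: if every linear subset C had a strict
-- upper bound f C, then C ↦ C ∪ { f C } would have a linear fixed point.
--
-- AxiomOfChoice ℓ only chooses over index types in Set ℓ, whereas predicates live
-- one level higher. Excluded middle for propositions repairs this: up to double
-- negation a predicate on A is a map A → Bool, and these form a type in Set ℓ.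
module Submission where

open import Defs
open import Axiom.Extensionality.Propositional using (Extensionality)
open import Axiom.UniquenessOfIdentityProofs.WithK using (uip)
open import Data.Bool.Base using (Bool; true; false; T)
open import Data.Bool.Properties using (T-irrelevant)
open import Data.Empty using (⊥; ⊥-elim)
open import Data.Maybe.Base using (Maybe; just; nothing)
open import Data.Maybe.Properties using (just-injective)
open import Data.Product using (Σ; ∃; _×_; _,_; proj₁; proj₂)
open import Data.Sum using (_⊎_; inj₁; inj₂)
open import Function.Base using (_∘_)
open import Function.Bundles using (_⇔_; mk⇔)
open import Function.Properties.Equivalence using () renaming (trans to ⇔-trans)
open import Level using (Level; Lift; lift)
open import Relation.Binary.PropositionalEquality
  using (_≡_; refl; sym; trans; cong; cong₂; isEquivalence)
open import Relation.Binary.Structures using (IsPartialOrder)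
open import Relation.Nullary using (¬_; yes; no; Irrelevant; contradiction)
open import Relation.Nullary.Decidable
  using (isYes; decidable-stable; toWitness; fromWitness)
open import Relation.Unary using (Pred; _∈_)

private variable
  a ℓ : Level

chainCondition∀⇒∃ : (P : PartialOrder ℓ) → let open PartialOrder P in
  (𝟏 x : Carrier) → ChainCondition∀ P 𝟏 x → ChainCondition∃ P 𝟏 x
chainCondition∀⇒∃ P 𝟏 x cc C u k =
  proj₁ (proj₁ u) λ (y , y∈C) → k (y , y∈C , cc C u y y∈C)

-- Since chains are nonempty, the existential condition is the weaker hypothesis. So it suffices to
-- derive this stronger criterion from Zorn's Lemma and Zorn's Lemma from the other one.
criterion∃⇒∀ : NonGeneratorCriterion∃ ℓ → NonGeneratorCriterion∀ ℓ
criterion∃⇒∀ crit P 𝟏 max x below cc =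
  crit P 𝟏 max x below (chainCondition∀⇒∃ P 𝟏 x cc)

-- Adjoining a top and an isolated point

module Adjoin (Q : PartialOrder ℓ) where
  private module Q = PartialOrder Q
  open IsPartialOrder Q.isPartialOrder using () renaming
    (refl to ≤-refl; trans to ≤-trans; antisym to ≤-antisym)

  data Adjoined : Set ℓ where
    top pt : Adjoined
    el     : Q.Carrier → Adjoined

  data _⊑_ : Adjoined → Adjoined → Set ℓ where
    ⊑top  : ∀ {x} → x ⊑ top
    pt⊑pt : pt ⊑ pt
    el⊑el : ∀ {q r} → q Q.≤ r → el q ⊑ el r

  ⊑-refl : ∀ {x} → x ⊑ x
  ⊑-refl {top}  = ⊑top
  ⊑-refl {pt}   = pt⊑pt
  ⊑-refl {el q} = el⊑el ≤-refl

  ⊑-trans : ∀ {x y z} → x ⊑ y → y ⊑ z → x ⊑ z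
  ⊑-trans _         ⊑top      = ⊑top
  ⊑-trans pt⊑pt     pt⊑pt     = pt⊑pt
  ⊑-trans (el⊑el p) (el⊑el q) = el⊑el (≤-trans p q)

  ⊑-antisym : ∀ {x y} → x ⊑ y → y ⊑ x → x ≡ y
  ⊑-antisym ⊑top      ⊑top      = refl
  ⊑-antisym pt⊑pt     _         = refl
  ⊑-antisym (el⊑el p) (el⊑el q) = cong el (≤-antisym p q)

  ⊑-irrelevant : ∀ {x y} (p q : x ⊑ y) → p ≡ q
  ⊑-irrelevant ⊑top      ⊑top      = refl
  ⊑-irrelevant pt⊑pt     pt⊑pt     = refl
  ⊑-irrelevant (el⊑el p) (el⊑el q) = cong el⊑el (Q.≤-irrelevant p q)

  adjoined : PartialOrder ℓ
  adjoined = record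
    { Carrier        = Adjoined
    ; _≤_            = _⊑_
    ; isPartialOrder = record
      { isPreorder = record
        { isEquivalence = isEquivalence
        ; reflexive     = λ { refl → ⊑-refl }
        ; trans         = ⊑-trans
        }
      ; antisym = ⊑-antisym
      }
    ; ≤-irrelevant = ⊑-irrelevant
    }
  open PartialOrder adjoined using (_<_)

  el<el : ∀ {q r} → q Q.< r → el q < el r
  el<el (q≤r , q≢r) = el⊑el q≤r , λ { refl → q≢r refl }

  -- Elements strictly above `q` in `Q` stay strictly between `el q` and `top`, so a maximal `el q`
  -- would make `q` maximal in `Q`.
  pt-belowMaximals : ¬ (∃ λ m → IsMaximal Q m) → BelowMaximals adjoined top pt
  pt-belowMaximals noMax top    ((_ , t≢t) , _) = contradiction refl t≢t
  pt-belowMaximals noMax pt     _               = pt⊑pt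
  pt-belowMaximals noMax (el q) (_ , max)       =
    ⊥-elim (noMax (q , λ (r , q<r) → max (el r , el<el q<r , ⊑top , λ ())))

  -- A chain below `top` that contains `pt` has no other member, so `pt` bounds it. Any other chain
  -- below `top` lies in the copy of `Q` and is bounded there.
  noUnbounded<1Chain : ¬ (∃ λ C → IsUnboundedChain Q C) →
    (C : Pred Adjoined ℓ) → ¬ IsUnbounded<1Chain adjoined top C
  noUnbounded<1Chain noChain C ((inhabited , linear) , below , unbounded) =
    inhabited λ
      { (top  , t∈C) → proj₂ (below top t∈C) refl
      ; (pt   , p∈C) → pt∉C p∈C
      ; (el q , q∈C) → noChain (C ∘ el , restrictedChain (q , q∈C) , restrictedUnbounded)
      }
    where
    pt∉C : ¬ (pt ∈ C)
    pt∉C pt∈C = unbounded (pt , (⊑top , λ ()) , bound)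
      where
      bound : ∀ x → x ∈ C → x ⊑ pt
      bound top    x∈C = contradiction refl (proj₂ (below top x∈C))
      bound pt     _   = pt⊑pt
      bound (el q) x∈C = ⊥-elim (linear pt (el q) pt∈C x∈C λ { (inj₁ ()) ; (inj₂ ()) })

    restrictedChain : (∃ λ q → el q ∈ C) → IsChain Q (C ∘ el)
    restrictedChain w = (λ k → k w) , λ x y x∈C y∈C k →
      linear (el x) (el y) x∈C y∈C λ
        { (inj₁ (el⊑el x≤y)) → k (inj₁ x≤y)
        ; (inj₂ (el⊑el y≤x)) → k (inj₂ y≤x) }

    restrictedUnbounded : ¬ (∃ λ q → ∀ x → el x ∈ C → x Q.≤ q)
    restrictedUnbounded (q , q-bound) = unbounded (el q , (⊑top , λ ()) , bound)
      where
      bound : ∀ x → x ∈ C → x ⊑ el q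
      bound top    x∈C = contradiction refl (proj₂ (below top x∈C))
      bound pt     x∈C = ⊥-elim (pt∉C x∈C)
      bound (el r) x∈C = el⊑el (q-bound r x∈C)

  el-joinIsTop : ∀ q → JoinIsTop adjoined top pt (el q)
  el-joinIsTop q (top , (_ , t≢t) , _)  = t≢t refl
  el-joinIsTop q (pt  , _ , _ , ())
  el-joinIsTop q (el _ , _ , () , _)

criterion∀⇒zorn : NonGeneratorCriterion∀ ℓ → ZornsLemma ℓ
criterion∀⇒zorn crit Q inhabited k = inhabited λ q → el≢top (
  crit adjoined top (λ _ → ⊑top) pt
    (pt-belowMaximals (k ∘ inj₁))
    (λ C u → ⊥-elim (noUnbounded<1Chain (k ∘ inj₂) C u))
    (el q) (el-joinIsTop q))
  where
  open Adjoin Q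
  el≢top : ∀ {q} → ¬ (el q ≡ top)
  el≢top ()

module _ (em : ∀ {ℓ} → PropositionalExcludedMiddle ℓ)
         (ext : ∀ {a b} → Extensionality a b) where

  -- Stability and irrelevance of propositions

  stable : {A : Set a} → Irrelevant A → ∥ A ∥ → A
  stable irr = decidable-stable (em irr)

  ¬-irrelevant : {A : Set a} → Irrelevant (¬ A)
  ¬-irrelevant ¬p ¬q = ext λ x → ⊥-elim (¬p x)

  Σ-≡-irrelevant : {A : Set a} {B : A → Set ℓ} → (∀ {x} → Irrelevant (B x)) →
    {u v : Σ A B} → proj₁ u ≡ proj₁ v → u ≡ v
  Σ-≡-irrelevant irr {x , b} {_ , b′} refl = cong (x ,_) (irr b b′)

  -- Zorn's Lemma implies the criterion

  module Interval (P : PartialOrder ℓ) (𝟏 e : PartialOrder.Carrier P) where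
    open PartialOrder P
    open IsPartialOrder isPartialOrder using () renaming
      (refl to ≤-refl; trans to ≤-trans; antisym to ≤-antisym)

    InInterval : Pred Carrier ℓ
    InInterval p = e ≤ p × p < 𝟏

    inInterval-irrelevant : ∀ {p} → Irrelevant (InInterval p)
    inInterval-irrelevant (e≤p , p≤𝟏 , p≢𝟏) (e≤p′ , p≤𝟏′ , p≢𝟏′) =
      cong₂ _,_ (≤-irrelevant e≤p e≤p′)
        (cong₂ _,_ (≤-irrelevant p≤𝟏 p≤𝟏′) (¬-irrelevant p≢𝟏 p≢𝟏′))

    interval : PartialOrder ℓ
    interval = record
      { Carrier        = Σ Carrier InInterval
      ; _≤_            = λ p q → proj₁ p ≤ proj₁ q
      ; isPartialOrder = record
        { isPreorder = record
          { isEquivalence = isEquivalence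
          ; reflexive     = λ { refl → ≤-refl }
          ; trans         = ≤-trans
          }
        ; antisym = λ p≤q q≤p → Σ-≡-irrelevant inInterval-irrelevant (≤-antisym p≤q q≤p)
        }
      ; ≤-irrelevant = ≤-irrelevant
      }

    maximal⇒maximal<1 : ∀ m → IsMaximal interval m → IsMaximal<1 P 𝟏 (proj₁ m)
    maximal⇒maximal<1 (m , e≤m , m<𝟏) max = m<𝟏 , λ (q , (m≤q , m≢q) , q<𝟏) →
      max ((q , ≤-trans e≤m m≤q , q<𝟏) , m≤q , m≢q ∘ cong proj₁)

    Image : Pred (Σ Carrier InInterval) ℓ → Pred Carrier ℓ
    Image C p = Σ (InInterval p) λ h → (p , h) ∈ C

    -- A bound below `𝟏` lies above some member of the chain, hence above `e`, so it would be a
    -- bound inside the interval.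
    unbounded⇒unbounded<1 : ∀ C → IsUnboundedChain interval C →
      IsUnbounded<1Chain P 𝟏 (Image C)
    unbounded⇒unbounded<1 C ((inhabited , linear) , unbounded) =
        ( (λ k → inhabited λ ((p , h) , p∈C) → k (p , h , p∈C))
        , (λ { x y (h , x∈C) (h′ , y∈C) → linear (x , h) (y , h′) x∈C y∈C }) )
      , (λ { x ((_ , x<𝟏) , _) → x<𝟏 })
      , λ (p , p<𝟏 , bound) → inhabited λ ((x , h) , x∈C) →
          unbounded ( (p , ≤-trans (proj₁ h) (bound x (h , x∈C)) , p<𝟏)
                    , λ { (y , h′) y∈C → bound y (h′ , y∈C) })

  zorn⇒criterion∃ : ZornsLemma ℓ → NonGeneratorCriterion∃ ℓ
  -- Equality with `𝟏` is a proposition, so contradiction is available; `e≢𝟏` puts `e` itself in the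
  -- interval.
  zorn⇒criterion∃ zorn P 𝟏 max x below cc e join = stable uip λ e≢𝟏 →
    zorn interval (λ k → k (e , ≤-refl , max e , e≢𝟏)) λ
      { (inj₁ (m@(p , e≤p , p<𝟏) , m-max)) →
          join (p , p<𝟏 , below p (maximal⇒maximal<1 m m-max) , e≤p)
      ; (inj₂ (C , u)) →
          cc (Image C) (unbounded⇒unbounded<1 C u) λ
            { (y , ((e≤y , _) , _) , common) → common λ (r , r<𝟏 , x≤r , y≤r) →
                join (r , r<𝟏 , x≤r , ≤-trans e≤y y≤r) } }
    where
    open Interval P 𝟏 e
    open PartialOrder P
    open IsPartialOrder isPartialOrder using () renaming
      (refl to ≤-refl; trans to ≤-trans)

  -- Zorn's Lemma implies the Axiom of Choice

  module PartialChoice (I : Set ℓ) (X : I → Set ℓ) where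

    -- With `Maybe`, the domain is decidable, so a value can be read off by cases without
    -- truncation.
    PartialSection : Set ℓ
    PartialSection = ∀ i → Maybe (X i)

    _⊑_ : PartialSection → PartialSection → Set ℓ
    s ⊑ t = ∀ i x → s i ≡ just x → t i ≡ just x

    ⊑-antisym : ∀ {s t} → s ⊑ t → t ⊑ s → s ≡ t
    ⊑-antisym {s} {t} s⊑t t⊑s = ext pointwise
      where
      pointwise : ∀ i → s i ≡ t i
      pointwise i with s i in eq | t i in eq′
      ... | just x  | _       = trans (sym (s⊑t i x eq)) eq′
      ... | nothing | just y  = trans (sym eq) (t⊑s i y eq′)
      ... | nothing | nothing = refl

    partialSections : PartialOrder ℓ
    partialSections = record
      { Carrier        = PartialSection
      ; _≤_            = _⊑_
      ; isPartialOrder = record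
        { isPreorder = record
          { isEquivalence = isEquivalence
          ; reflexive     = λ { refl i x eq → eq }
          ; trans         = λ s⊑t t⊑u i x eq → t⊑u i x (s⊑t i x eq)
          }
        ; antisym = ⊑-antisym
        }
      ; ≤-irrelevant = λ p q → ext λ i → ext λ x → ext λ eq → uip _ _
      }
    open PartialOrder partialSections using (_<_)

    extend : PartialSection → ∀ i → X i → PartialSection
    extend s i x j with em {P = i ≡ j} uip
    ... | yes refl = just x
    ... | no _     = s j

    extend-at : ∀ s i x → extend s i x i ≡ just x
    extend-at s i x with em {P = i ≡ i} uip
    ... | yes refl = refl
    ... | no i≢i   = contradiction refl i≢i

    extend-⊒ : ∀ s i x → s i ≡ nothing → s ⊑ extend s i x
    extend-⊒ s i x si≡nothing j y sj≡y with em {P = i ≡ j} uip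
    ... | yes refl = contradiction (trans (sym si≡nothing) sj≡y) λ ()
    ... | no _     = sj≡y

    extend-> : ∀ s i x → s i ≡ nothing → s < extend s i x
    extend-> s i x si≡nothing = extend-⊒ s i x si≡nothing , λ s≡t →
      contradiction
        (trans (sym si≡nothing) (trans (cong (λ u → u i) s≡t) (extend-at s i x))) λ ()

    -- The truncated inhabitant of `X i` serves only to refute `nothing`, so no element is chosen.
    maximal⇒section : (∀ i → ∥ X i ∥) → ∀ s → IsMaximal partialSections s → ∀ i → X i
    maximal⇒section inhabited s max i with s i in eq
    ... | just x  = x
    ... | nothing = ⊥-elim (inhabited i λ x → max (extend s i x , extend-> s i x eq))

    module Union (C : Pred PartialSection ℓ) (chain : IsChain partialSections C) where

      Value : I → Set ℓ
      Value i = ∃ λ x → ∥ (∃ λ s → s ∈ C × s i ≡ just x) ∥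

      -- Values along a chain agree, so excluded middle for propositions decides
      -- whether there is one and returns it: this is unique choice.
      value-irrelevant : ∀ i → Irrelevant (Value i)
      value-irrelevant i (x , p) (y , q) = Σ-≡-irrelevant ¬-irrelevant (stable uip λ x≢y →
        p λ (s , s∈C , si≡x) → q λ (t , t∈C , ti≡y) →
        proj₂ chain s t s∈C t∈C λ
          { (inj₁ s⊑t) → x≢y (just-injective (trans (sym (s⊑t i x si≡x)) ti≡y))
          ; (inj₂ t⊑s) → x≢y (just-injective (trans (sym si≡x) (t⊑s i y ti≡y))) })

      union : PartialSection
      union i with em (value-irrelevant i)
      ... | yes (x , _) = just x
      ... | no _        = nothing

      union-bound : ∀ s → s ∈ C → s ⊑ union
      union-bound s s∈C i x si≡x with em (value-irrelevant i)
      ... | yes v    = cong (just ∘ proj₁)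
                         (value-irrelevant i v (x , λ k → k (s , s∈C , si≡x)))
      ... | no noVal = contradiction (x , λ k → k (s , s∈C , si≡x)) noVal

  zorn⇒choice : ZornsLemma ℓ → AxiomOfChoice ℓ
  zorn⇒choice zorn I X inhabited k =
    -- The section defined nowhere shows that the poset is nonempty.
    zorn partialSections (λ j → j λ _ → nothing) λ
      { (inj₁ (s , max))             → k (maximal⇒section inhabited s max)
      ; (inj₂ (C , chain , unbounded)) →
          unbounded (Union.union C chain , Union.union-bound C chain) }
    where open PartialChoice I X

  -- The Axiom of Choice implies Zorn's Lemma

  -- Truncating first makes `em` applicable; the price is that `⟦⟧-elim` returns only a double
  -- negation.
  ⟦_⟧ : {A : Set a} → Pred A ℓ → A → Bool
  ⟦ P ⟧ x = isYes (em {P = ∥ P x ∥} ¬-irrelevant)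

  ⟦⟧-intro : {A : Set a} (P : Pred A ℓ) {x : A} → P x → T (⟦ P ⟧ x)
  ⟦⟧-intro P p = fromWitness λ k → k p

  ⟦⟧-elim : {A : Set a} (P : Pred A ℓ) {x : A} → T (⟦ P ⟧ x) → ∥ P x ∥
  ⟦⟧-elim P = toWitness

  -- Fixed points of inflationary maps

  module _ (L : PartialOrder ℓ) where
    open PartialOrder L

    -- The argument of Bourbaki and Witt: the closure of ∅ under an inflationary map
    -- g and suprema is linearly ordered, and its supremum is a fixed point of g.
    module InflationaryMap
      (⋁ : (Carrier → Bool) → Carrier)
      (⋁-upper : ∀ F x → T (F x) → x ≤ ⋁ F)
      (⋁-least : ∀ F y → (∀ x → T (F x) → x ≤ y) → ⋁ F ≤ y)
      (g : Carrier → Carrier) (g-inflationary : ∀ x → x ≤ g x) where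

      open IsPartialOrder isPartialOrder using () renaming
        (refl to ≤-refl; trans to ≤-trans; antisym to ≤-antisym)

      Closed : (Carrier → Bool) → Set ℓ
      Closed S = (∀ x → T (S x) → T (S (g x)))
               × (∀ F → (∀ x → T (F x) → T (S x)) → T (S (⋁ F)))

      -- An inductive definition would not do: ⟦ Tower ⟧ gives Tower x only up to
      -- double negation, which breaks strict positivity in the case of suprema.
      Tower : Pred Carrier ℓ
      Tower x = ∀ S → Closed S → T (S x)

      tower-step : ∀ {x} → Tower x → Tower (g x)
      tower-step tx S closed = proj₁ closed _ (tx S closed)

      tower-⋁ : ∀ F → (∀ x → T (F x) → Tower x) → Tower (⋁ F)
      tower-⋁ F towers S closed = proj₂ closed F λ x x∈F → towers x x∈F S closed

      tower-stable : ∀ {x} → ∥ Tower x ∥ → Tower x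
      tower-stable ttx S closed = stable T-irrelevant λ x∉S → ttx λ tx → x∉S (tx S closed)

      -- The tower elements satisfying `P` form a closed subset, against which `Tower` is tested.
      -- Stability of `P` undoes the truncation in `⟦_⟧`.
      tower-induction : (P : Pred Carrier ℓ) → (∀ {x} → ∥ P x ∥ → P x) →
        (∀ {x} → Tower x → P x → P (g x)) →
        (∀ F → (∀ x → T (F x) → Tower x) → (∀ x → T (F x) → P x) → P (⋁ F)) →
        ∀ {x} → Tower x → P x
      tower-induction P P-stable P-step P-⋁ tx =
        P-stable λ ¬px → ⟦⟧-elim Tower×P (tx ⟦ Tower×P ⟧ (closed-step , closed-⋁)) (¬px ∘ proj₂)
        where
        Tower×P : Pred Carrier ℓ
        Tower×P x = Tower x × P x

        elim : ∀ {x} → T (⟦ Tower×P ⟧ x) → Tower×P x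
        elim x∈ = tower-stable (λ k → ⟦⟧-elim Tower×P x∈ (k ∘ proj₁))
                , P-stable (λ k → ⟦⟧-elim Tower×P x∈ (k ∘ proj₂))

        closed-step : ∀ x → T (⟦ Tower×P ⟧ x) → T (⟦ Tower×P ⟧ (g x))
        closed-step x x∈ = let tx , px = elim x∈ in
          ⟦⟧-intro Tower×P (tower-step tx , P-step tx px)

        closed-⋁ : ∀ F → (∀ x → T (F x) → T (⟦ Tower×P ⟧ x)) → T (⟦ Tower×P ⟧ (⋁ F))
        closed-⋁ F F⊆ = ⟦⟧-intro Tower×P
          ( tower-⋁ F (λ x → proj₁ ∘ elim ∘ F⊆ x)
          , P-⋁ F (λ x → proj₁ ∘ elim ∘ F⊆ x) (λ x → proj₂ ∘ elim ∘ F⊆ x))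

      -- These are the extreme points of the Bourbaki-Witt proof: `g` never jumps from below `x`
      -- past `x`.
      Extreme : Pred Carrier ℓ
      Extreme x = ∀ y → Tower y → y < x → g y ≤ x

      -- Induction on `y`. If `y` is strictly below `x`, extremeness bounds `g y`; if they are
      -- equal, so are their images. For a supremum, either some member is above `g x` or `x` bounds
      -- them all.
      extreme-compare : ∀ {x} → Extreme x → ∀ {y} → Tower y → ∥ (y ≤ x ⊎ g x ≤ y) ∥
      extreme-compare {x} ex = tower-induction _ (λ k j → k λ i → i j) compare-step compare-⋁
        where
        compare-step : ∀ {y} → Tower y → ∥ (y ≤ x ⊎ g x ≤ y) ∥ → ∥ (g y ≤ x ⊎ g x ≤ g y) ∥
        compare-step {y} ty ih k = ih λ
          { (inj₁ y≤x) →
              let y≢x : ¬ (y ≡ x)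
                  y≢x = λ { refl → k (inj₂ ≤-refl) }
              in k (inj₁ (ex y ty (y≤x , y≢x)))
          ; (inj₂ gx≤y) → k (inj₂ (≤-trans gx≤y (g-inflationary y))) }

        compare-⋁ : ∀ F → (∀ y → T (F y) → Tower y) →
          (∀ y → T (F y) → ∥ (y ≤ x ⊎ g x ≤ y) ∥) → ∥ (⋁ F ≤ x ⊎ g x ≤ ⋁ F) ∥
        compare-⋁ F _ ih k =
          k (inj₁ (⋁-least F x λ y y∈F → stable ≤-irrelevant λ y≰x →
            ih y y∈F λ
              { (inj₁ y≤x)  → y≰x y≤x
              ; (inj₂ gx≤y) → k (inj₂ (≤-trans gx≤y (⋁-upper F y y∈F))) }))

      -- Induction on `x`, where the extremeness already known allows `y` to be compared with `x`,
      -- or with each member of the family.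
      tower-extreme : ∀ {x} → Tower x → Extreme x
      tower-extreme = tower-induction Extreme
        (λ k y ty y<x → stable ≤-irrelevant λ gy≰x → k λ ex → gy≰x (ex y ty y<x))
        extreme-step extreme-⋁
        where
        extreme-step : ∀ {x} → Tower x → Extreme x → Extreme (g x)
        extreme-step {x} tx ex y ty (y≤gx , y≢gx) = stable ≤-irrelevant λ gy≰gx →
          extreme-compare ex ty λ
            { (inj₁ y≤x) →
                let y≢x : ¬ (y ≡ x)
                    y≢x = λ { refl → gy≰gx ≤-refl }
                in gy≰gx (≤-trans (ex y ty (y≤x , y≢x)) (g-inflationary x))
            ; (inj₂ gx≤y) → y≢gx (≤-antisym y≤gx gx≤y) }

        extreme-⋁ : ∀ F → (∀ x → T (F x) → Tower x) →
          (∀ x → T (F x) → Extreme x) → Extreme (⋁ F)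
        -- If `g y` is not below the supremum, no member exceeds `y`, so `y` is the supremum itself.
        extreme-⋁ F towers ih y ty (y≤⋁ , y≢⋁) = stable ≤-irrelevant λ gy≰⋁ →
          y≢⋁ (≤-antisym y≤⋁ (⋁-least F y λ z z∈F → stable ≤-irrelevant λ z≰y →
            extreme-compare (ih z z∈F) ty λ
              { (inj₁ y≤z) →
                  let y≢z : ¬ (y ≡ z)
                      y≢z = λ { refl → z≰y ≤-refl }
                  in gy≰⋁ (≤-trans (ih z z∈F y ty (y≤z , y≢z)) (⋁-upper F z z∈F))
              ; (inj₂ gz≤y) → z≰y (≤-trans (g-inflationary z) gz≤y) }))

      tower-linear : ∀ {x y} → Tower x → Tower y → ∥ (x ≤ y ⊎ y ≤ x) ∥
      tower-linear {x} tx ty k = extreme-compare (tower-extreme tx) ty λ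
        { (inj₁ y≤x)  → k (inj₂ y≤x)
        ; (inj₂ gx≤y) → k (inj₁ (≤-trans (g-inflationary x) gx≤y)) }

      -- The supremum of the whole tower is in the tower, so its image under `g` is too and lies
      -- below it.
      tower-fixedPoint : ∃ λ x → Tower x × g x ≤ x
      tower-fixedPoint =
        ⋁ ⟦ Tower ⟧ , tower-max , ⋁-upper _ _ (⟦⟧-intro Tower (tower-step tower-max))
        where
        tower-max : Tower (⋁ ⟦ Tower ⟧)
        tower-max = tower-⋁ ⟦ Tower ⟧ λ x → tower-stable ∘ ⟦⟧-elim Tower

  -- Boolean subsets as a complete lattice

  module Powerset (A : Set ℓ) where

    Subset : Set ℓ
    Subset = A → Bool

    _⊆_ : Subset → Subset → Set ℓ
    C ⊆ D = ∀ x → T (C x) → T (D x)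

    T-antisym : ∀ {b c} → (T b → T c) → (T c → T b) → b ≡ c
    T-antisym {false} {false} _ _ = refl
    T-antisym {true}  {true}  _ _ = refl
    T-antisym {false} {true}  _ g = ⊥-elim (g _)
    T-antisym {true}  {false} f _ = ⊥-elim (f _)

    powerset : PartialOrder ℓ
    powerset = record
      { Carrier        = Subset
      ; _≤_            = _⊆_
      ; isPartialOrder = record
        { isPreorder = record
          { isEquivalence = isEquivalence
          ; reflexive     = λ { refl x x∈C → x∈C }
          ; trans         = λ C⊆D D⊆E x x∈C → D⊆E x (C⊆D x x∈C)
          }
        ; antisym = λ C⊆D D⊆C → ext λ x → T-antisym (C⊆D x) (D⊆C x)
        }
      ; ≤-irrelevant = λ p q → ext λ x → ext λ x∈C → T-irrelevant _ _
      }

    InUnion : (Subset → Bool) → Pred A ℓ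
    InUnion F x = ∃ λ C → T (F C) × T (C x)

    ⋃ : (Subset → Bool) → Subset
    ⋃ F = ⟦ InUnion F ⟧

    ⋃-upper : ∀ F C → T (F C) → C ⊆ ⋃ F
    ⋃-upper F C C∈F x x∈C = ⟦⟧-intro (InUnion F) (C , C∈F , x∈C)

    ⋃-least : ∀ F D → (∀ C → T (F C) → C ⊆ D) → ⋃ F ⊆ D
    ⋃-least F D bound x x∈⋃ = stable T-irrelevant λ x∉D →
      ⟦⟧-elim (InUnion F) x∈⋃ λ (C , C∈F , x∈C) → x∉D (bound C C∈F x x∈C)

  -- Unlike in `IsChain`, the empty subset counts: it is the union of the empty family, so the tower
  -- contains it.
  Linear : (Q : PartialOrder ℓ) → let open PartialOrder Q in (Carrier → Bool) → Set ℓ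
  Linear Q C = ∀ x y → T (C x) → T (C y) → ∥ (x ≤ y ⊎ y ≤ x) ∥
    where open PartialOrder Q

  -- Strict upper bounds for all linear subsets are impossible

  module _ (Q : PartialOrder ℓ) where
    open PartialOrder Q
    open Powerset Carrier

    module StrictBounds
      (f : Subset → Carrier) (f-bound : ∀ C → Linear Q C → ∀ x → T (C x) → x < f C) where

      open IsPartialOrder isPartialOrder using () renaming (refl to ≤-refl)

      Inserted : Subset → Pred Carrier ℓ
      Inserted C x = T (C x) ⊎ x ≡ f C

      insert : Subset → Subset
      insert C = ⟦ Inserted C ⟧

      insert-inflationary : ∀ C → C ⊆ insert C
      insert-inflationary C x x∈C = ⟦⟧-intro (Inserted C) (inj₁ x∈C)

      open InflationaryMap powerset ⋃ ⋃-upper ⋃-least insert insert-inflationary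

      insert-linear : ∀ C → Linear Q C → Linear Q (insert C)
      insert-linear C lin x y x∈ y∈ k =
        ⟦⟧-elim (Inserted C) x∈ λ x∈′ → ⟦⟧-elim (Inserted C) y∈ λ y∈′ → cases x∈′ y∈′
        where
        cases : Inserted C x → Inserted C y → ⊥
        cases (inj₁ x∈C)  (inj₁ y∈C)  = lin x y x∈C y∈C k
        cases (inj₁ x∈C)  (inj₂ refl) = k (inj₁ (proj₁ (f-bound C lin x x∈C)))
        cases (inj₂ refl) (inj₁ y∈C)  = k (inj₂ (proj₁ (f-bound C lin y y∈C)))
        cases (inj₂ refl) (inj₂ refl) = k (inj₁ ≤-refl)

      -- Tower members are nested, so two points of the union lie in a single member of the family.
      ⋃-linear : ∀ F → (∀ C → T (F C) → Tower C) → (∀ C → T (F C) → Linear Q C) →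
        Linear Q (⋃ F)
      ⋃-linear F towers lin x y x∈ y∈ k =
        ⟦⟧-elim (InUnion F) x∈ λ (C , C∈F , x∈C) →
        ⟦⟧-elim (InUnion F) y∈ λ (D , D∈F , y∈D) →
        tower-linear (towers C C∈F) (towers D D∈F) λ
          { (inj₁ C⊆D) → lin D D∈F x y (C⊆D x x∈C) y∈D k
          ; (inj₂ D⊆C) → lin C C∈F x y x∈C (D⊆C y y∈D) k }

      tower⇒linear : ∀ {C} → Tower C → Linear Q C
      tower⇒linear = tower-induction (Linear Q)
        (λ k x y x∈C y∈C j → k λ lin → lin x y x∈C y∈C j)
        (λ {C} _ → insert-linear C) ⋃-linear

      -- A fixed point `C` of `insert` contains `f C`, which would then be strictly below itself.
      inconsistent : ⊥
      inconsistent = let C , tC , insert⊆C = tower-fixedPoint in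
        proj₂ (f-bound C (tower⇒linear tC) (f C)
          (insert⊆C (f C) (⟦⟧-intro (Inserted C) (inj₂ refl)))) refl

  choice⇒zorn : AxiomOfChoice ℓ → ZornsLemma ℓ
  choice⇒zorn choice Q inhabited k =
    choice Subset StrictBound strictBound λ bounds →
      StrictBounds.inconsistent Q (proj₁ ∘ bounds) (proj₂ ∘ bounds)
    where
    open PartialOrder Q
    open IsPartialOrder isPartialOrder using () renaming
      (trans to ≤-trans; antisym to ≤-antisym)
    open Powerset Carrier

    -- Linearity comes after `q`, so that choice can range over all subsets and the selected point
    -- does not depend on a proof of linearity.
    StrictBound : Subset → Set _
    StrictBound C = Σ Carrier λ q → Linear Q C → ∀ x → T (C x) → x < q

    strictBound : ∀ C → ∥ StrictBound C ∥
    -- The default `q₀` works vacuously unless `C` is linear with a member `x`; then `C` is a chain.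
    strictBound C noBound = inhabited λ q₀ → noBound (q₀ , λ lin x x∈C →
      ⊥-elim (k (inj₂ (Member ,
        ( (λ j → j (x , lift x∈C))
        , λ { y z (lift y∈C) (lift z∈C) → lin y z y∈C z∈C } )
        -- Anything strictly above a bound `q` of `C` would be a strict bound, so `q` would be
        -- maximal.
        , λ (q , bound) → k (inj₁ (q , λ (r , q≤r , q≢r) →
            noBound (r , λ _ y y∈C →
              ≤-trans (bound y (lift y∈C)) q≤r ,
              λ { refl → q≢r (≤-antisym q≤r (bound y (lift y∈C))) })))))))
      where
      Member : Pred Carrier _
      Member y = Lift _ (T (C y))

corollary2p4 : (∀ {ℓ} → PropositionalExcludedMiddle ℓ) →
    (∀ {a b} → Extensionality a b) →
    ∀ ℓ →
    ((NonGeneratorCriterion∀ ℓ ⇔ ZornsLemma ℓ) × (NonGeneratorCriterion∀ ℓ ⇔ AxiomOfChoice ℓ))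
    × ((NonGeneratorCriterion∃ ℓ ⇔ ZornsLemma ℓ) × (NonGeneratorCriterion∃ ℓ ⇔ AxiomOfChoice ℓ))
corollary2p4 em ext ℓ =
  (criterion∀⇔zorn , ⇔-trans criterion∀⇔zorn zorn⇔choice) ,
  (criterion∃⇔zorn , ⇔-trans criterion∃⇔zorn zorn⇔choice)
  where
  zorn⇔choice : ZornsLemma ℓ ⇔ AxiomOfChoice ℓ
  zorn⇔choice = mk⇔ (zorn⇒choice em ext) (choice⇒zorn em ext)

  criterion∀⇔zorn : NonGeneratorCriterion∀ ℓ ⇔ ZornsLemma ℓ
  criterion∀⇔zorn = mk⇔ criterion∀⇒zorn (criterion∃⇒∀ ∘ zorn⇒criterion∃ em ext)

  criterion∃⇔zorn : NonGeneratorCriterion∃ ℓ ⇔ ZornsLemma ℓ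
  criterion∃⇔zorn = mk⇔ (criterion∀⇒zorn ∘ criterion∃⇒∀) (zorn⇒criterion∃ em ext)
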